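{- Let $\theta$ be an automorphism or an anti-automorphism of $A^*$. Every regular $\underline{\theta}$-independent code $X\subseteq A^*$ can be embedded into some complete one; that is, there exists a complete regular $\underline{\theta}$-independent code $Z\subseteq A^*$ with $X\subseteq Z$.
   Context: $A$ is a finite alphabet with $|A|\ge 2$; $A^*$ is the free monoid over $A$. An anti-automorphism of $A^*$ is a bijection $\theta:A^*\to A^*$ with $\theta(uv)=\theta(v)\theta(u)$ for all $u,v\in A^*$; an automorphism is a monoid automorphism of $A^*$. $\underline{\theta}=\{(w,\theta(w)):w\in A^*,\ \theta(w)\ne w\}$. For a relation $\tau\subseteq A^*\times A^*$, $\tau(X)=\{y:\exists x\in X,\ (x,y)\in\tau\}$, and $X$ is $\tau$-independent if $\tau(X)\cap X=\emptyset$. A subset of $A^*$ is regular if it is recognized by a finite automaton. A set $X\subseteq A^*$ is a code if for all words $x_1,\dots,x_n,y_1,\dots,y_p\in X$, $x_1\cdots x_n=y_1\cdots y_p$ implies $n=p$ and $x_i=y_i$ for every $i$. $X$ is complete if every word of $A^*$ is a factor (contiguous subword) of some word in $X^*$, the submonoid generated by $X$. -}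

module Defs where

open import Data.Fin.Base using (Fin)
import Data.Fin.Subset as Subset
open import Data.List.Base using (List; _++_; concat; foldl; ++-[]-rawMonoid)
open import Data.List.Relation.Binary.Infix.Heterogeneous using (Infix)
open import Data.List.Relation.Unary.All using (All)
open import Data.Nat.Base using (ℕ)
open import Data.Product.Base using (∃; ∃-syntax; _×_)
open import Algebra.Morphism.Structures using (module MonoidMorphisms)
open import Function.Definitions using (Bijective)
open import Level using (0ℓ)
open import Relation.Binary.Core using (Rel)
open import Relation.Binary.PropositionalEquality.Core using (_≡_; _≢_)
open import Relation.Unary using (Pred; _⊥_; _≐_)

Word : Set → Set
Word A = List A

Language : Set → Set₁
Language A = Pred (Word A) 0ℓ

module _ {A : Set} where

  IsAutomorphism : (Word A → Word A) → Set
  IsAutomorphism =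
    MonoidMorphisms.IsMonoidIsomorphism (++-[]-rawMonoid A) (++-[]-rawMonoid A)

  record IsAntiAutomorphism (θ : Word A → Word A) : Set where
    field
      bijective : Bijective _≡_ _≡_ θ
      anti-homo : ∀ u v → θ (u ++ v) ≡ θ v ++ θ u

  -- The graph of θ with its fixed points removed.
  Underline : (Word A → Word A) → Rel (Word A) 0ℓ
  Underline θ w v = v ≡ θ w × θ w ≢ w

  Image : Rel (Word A) 0ℓ → Language A → Language A
  Image τ X y = ∃[ x ] (X x × τ x y)

  Independent : Rel (Word A) 0ℓ → Language A → Set
  Independent τ X = Image τ X ⊥ X

  -- The submonoid generated by X.
  Star : Language A → Language A
  Star X w = ∃[ xs ] (All X xs × concat xs ≡ w)

  -- Equality of the lists is n = p together with xᵢ = yᵢ for every i.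
  -- Allowing empty lists only adds that the empty word is not in X, which
  -- is already forced by ε = ε · ε.
  IsCode : Language A → Set
  IsCode X = ∀ (xs ys : List (Word A)) → All X xs → All X ys →
             concat xs ≡ concat ys → xs ≡ ys

  IsComplete : Language A → Set
  IsComplete X = ∀ (w : Word A) → ∃[ z ] (Star X z × Infix _≡_ w z)

record DFA (A : Set) : Set where
  field
    size  : ℕ
    start : Fin size
    step  : Fin size → A → Fin size
    final : Subset.Subset size

  Recognized : Language A
  Recognized w = foldl step start w Subset.∈ final

IsRegular : {A : Set} → Language A → Set
IsRegular {A} X = ∃ λ (M : DFA A) → X ≐ DFA.Recognized M

{-# OPTIONS --safe #-}

-- If X is not complete, some word y₀ is not a factor of X*.  For an unbordered y containing
-- y₀, put Y = y(Uy)* with U = A* \ (X* ∪ A*yA*); then X ∪ Y is a complete code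
-- (Ehrenfeucht and Rozenberg): in a product of its words the occurrences of y do not
-- overlap, so the stretches between them are determined, and those in X* factor uniquely.
-- If y also contains θ(y₀) and θ⁻¹(y₀), neither θ nor θ⁻¹ maps a word of X to a word
-- containing y.  Every word of Y begins and ends with y, so for z and θ(z) in Y the word θ(y)
-- is a prefix of θ(z) of the same length as y; hence θ(y) = y, which is excluded unless θ is
-- the identity.  All this holds for y = a b w bⁿ⁺² with w = y₀ θ(y₀) θ⁻¹(y₀), n = |w| and a ≠ b,
-- where θ(a) ≠ a if θ is an automorphism other than the identity.

module Submission where

open import Defs
open import Algebra.Morphism.Structures using (module MonoidMorphisms)
open import Data.Bool.Base using (true; if_then_else_)
open import Data.Empty using (⊥)
open import Data.Fin.Base using (Fin; zero; suc; toℕ; fromℕ<; finToFun; funToFin)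
import Data.Fin.Properties as Fin
open import Data.Fin.Properties using (any?; pigeonhole; finToFun-funToFin; +↔⊎; toℕ≤pred[n])
import Data.Fin.Subset as Subset
open import Data.Fin.Subset.Properties using (_∈?_)
open import Data.List.Base
  using (List; []; _∷_; _++_; concat; drop; filter; foldl; length; replicate; take)
open import Data.List.Properties
  using ( ++-assoc; ++-cancelˡ; ++-identityʳ; ++-identityʳ-unique; ∷-injective; ≡-dec; concat-++
        ; filter-++; filter-accept; filter-none; foldl-++; length-++; length-++-≤ˡ; length-++-≤ʳ
        ; length-drop; length-replicate; length-take; take++drop≡id)
open import Data.List.Relation.Binary.Infix.Heterogeneous using (MkView; fromView)
import Data.List.Relation.Binary.Pointwise.Properties as Pointwise
import Data.List.Relation.Unary.All as All
open import Data.List.Relation.Unary.All using (All; []; _∷_)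
open import Data.List.Relation.Unary.All.Properties using (++⁺; ++⁻ʳ; replicate⁺)
open import Data.Nat.Base
  using (ℕ; zero; suc; _+_; _∸_; _⊓_; _^_; _≤_; _<_; z≤n; s≤s)
open import Data.Nat.Induction using (<-wellFounded)
open import Data.Nat.Properties
open import Data.Product.Base using (∃; ∃₂; ∃-syntax; _×_; _,_; proj₁; proj₂)
open import Data.Sum.Base using (_⊎_; inj₁; inj₂; [_,_]; [_,_]′)
open import Data.Unit.Base using (⊤; tt)
open import Data.Vec.Base using (tabulate)
open import Data.Vec.Properties using (lookup⇒[]=; []=⇒lookup; lookup∘tabulate)
open import Function.Base using (_∘_)
open import Function.Bundles using (_↔_; _⇔_; mk⇔; Inverse; Equivalence)
open import Function.Construct.Composition using (_⇔-∘_)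
open import Function.Definitions using (Injective)
open import Function.Properties.Inverse using (↔⇒↣; ↔-refl; ↔-sym)
open import Induction.WellFounded using (Acc; acc)
open import Level using (0ℓ)
open import Relation.Binary.PropositionalEquality
  using (_≡_; _≢_; refl; sym; trans; cong; cong₂; subst; module ≡-Reasoning)
open import Relation.Nullary using (Dec; yes; no; ¬_; does; contradiction)
open import Relation.Nullary.Decidable
  using (map′; _×-dec_; _⊎-dec_; ¬?; decidable-stable; dec-true; via-injection)
open import Relation.Unary using (Pred; Decidable; _≐_; _∪_; ∁; ｛_｝; _⊆_)
import Relation.Unary.Properties as Unary

-- Regular languages

module _ {A : Set} where

  infixr 6 _·_

  _·_ : Language A → Language A → Language A
  (L · K) w = ∃₂ λ u v → w ≡ u ++ v × L u × K v

  Anything : Language A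
  Anything _ = ⊤

  Factors : Language A → Language A
  Factors L w = ∃₂ λ u v → L (u ++ w ++ v)

  Prefixes : Language A → Language A
  Prefixes L w = ∃ λ v → L (w ++ v)

  Suffixes : Language A → Language A
  Suffixes L w = ∃ λ u → L (u ++ w)

  accepts : (M : DFA A) → Fin (DFA.size M) → Language A
  accepts M q w = foldl (DFA.step M) q w Subset.∈ DFA.final M

  regular⇒decidable : ∀ {L : Language A} → IsRegular L → Decidable L
  regular⇒decidable (M , L⊆M , M⊆L) w =
    map′ M⊆L L⊆M (foldl (DFA.step M) (DFA.start M) w ∈? DFA.final M)

  regular-resp-≐ : ∀ {L K : Language A} → L ≐ K → IsRegular K → IsRegular L
  regular-resp-≐ L≐K (M , K≐M) = M , Unary.≐-trans L≐K K≐M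

∈-tabulate-does : ∀ {n} {P : Pred (Fin n) 0ℓ} (P? : Decidable P) i →
                  P i ⇔ i Subset.∈ tabulate (does ∘ P?)
∈-tabulate-does P? i = mk⇔
  (λ p → lookup⇒[]= i _ (trans (lookup∘tabulate (does ∘ P?) i) (dec-true (P? i) p)))
  (λ i∈ → true⇒ (P? i) (trans (sym (lookup∘tabulate (does ∘ P?) i)) ([]=⇒lookup i∈)))
  where
  true⇒ : ∀ {Q : Set} (Q? : Dec Q) → does Q? ≡ true → Q
  true⇒ (yes q) _ = q

module _ {A : Set} where

  -- A finite family closed under left quotients by letters is its own automaton: the member `s` is
  -- what is accepted from the state `s`, final when it contains the empty word.
  regular-family :
    ∀ {n} (L : Fin n → Language A) (step : Fin n → A → Fin n) →
    (∀ s → Dec (L s [])) → (∀ s a w → L s (a ∷ w) ⇔ L (step s a) w) →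
    ∀ s → IsRegular (L s)
  regular-family L step ε? law s =
    record { size = _ ; start = s ; step = step ; final = tabulate (does ∘ ε?) } ,
    (λ {w} → Equivalence.to (run s w)) , (λ {w} → Equivalence.from (run s w))
    where
    run : ∀ s w → L s w ⇔ foldl step s w Subset.∈ tabulate (does ∘ ε?)
    run s []      = ∈-tabulate-does ε? s
    run s (a ∷ w) = run (step s a) w ⇔-∘ law s a w

-- Nondeterministic automata and the subset construction

module _ {S : Set} {n : ℕ} (S↔n : S ↔ Fin n) where

  open Inverse S↔n using (to; from; strictlyInverseʳ)

  any↔? : {P : Pred S 0ℓ} → Decidable P → Dec (∃ P)
  any↔? {P} P? = map′ (λ (i , p) → from i , p)
    (λ (s , p) → to s , subst P (sym (strictlyInverseʳ s)) p) (any? (P? ∘ from))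

  -- Subsets of S are coded as elements of Fin (2 ^ n).
  _∋_ : Fin (2 ^ n) → S → Set
  c ∋ s = finToFun c (to s) ≡ suc zero

  bit : {P : Set} → Dec P → Fin 2
  bit P? = if does P? then suc zero else zero

  encode : {P : Pred S 0ℓ} → Decidable P → Fin (2 ^ n)
  encode P? = funToFin (bit ∘ P? ∘ from)

  encode-∋ : ∀ {P : Pred S 0ℓ} (P? : Decidable P) s → encode P? ∋ s ⇔ P s
  encode-∋ {P} P? s = mk⇔
    (λ e → subst P (strictlyInverseʳ s) (bit⇒ (P? (from (to s)))
      (trans (sym (finToFun-funToFin (bit ∘ P? ∘ from) (to s))) e)))
    (λ p → trans (finToFun-funToFin (bit ∘ P? ∘ from) (to s))
      (⇒bit (P? (from (to s))) (subst P (sym (strictlyInverseʳ s)) p)))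
    where
    bit⇒ : ∀ {Q : Set} (Q? : Dec Q) → bit Q? ≡ suc zero → Q
    bit⇒ (yes q) _ = q
    ⇒bit : ∀ {Q : Set} (Q? : Dec Q) → Q → bit Q? ≡ suc zero
    ⇒bit (yes _) _ = refl
    ⇒bit (no ¬q) q = contradiction q ¬q

  module _ {A : Set} where

    -- The subset construction, for a nondeterministic automaton given through
    -- the languages accepted from its states.
    regular-nfa :
      (L : S → Language A) {_⟶[_]_ : S → A → S → Set} →
      (∀ s a t → Dec (s ⟶[ a ] t)) → (∀ s → Dec (L s [])) →
      (∀ s a w → L s (a ∷ w) ⇔ (∃ λ t → s ⟶[ a ] t × L t w)) →
      {I : Pred S 0ℓ} → Decidable I → IsRegular (λ w → ∃ λ s → I s × L s w)
    regular-nfa L {_⟶[_]_} ⟶? ε? law I? = regular-resp-≐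
      ( (λ (s , i , l) → s , Equivalence.from (encode-∋ I? s) i , l)
      , (λ (s , i , l) → s , Equivalence.to (encode-∋ I? s) i , l))
      (regular-family K step (λ c → any↔? (λ s → c ∋? s ×-dec ε? s)) K-law (encode I?))
      where
      -- Taking the union over a set of states turns the nondeterministic law into a left quotient
      -- law, as `regular-family` requires.
      K : Fin (2 ^ n) → Language A
      K c w = ∃ λ s → c ∋ s × L s w

      _∋?_ : ∀ c s → Dec (c ∋ s)
      c ∋? s = finToFun c (to s) Fin.≟ suc zero

      next? : ∀ c a t → Dec (∃ λ s → c ∋ s × (s ⟶[ a ] t))
      next? c a t = any↔? (λ s → c ∋? s ×-dec ⟶? s a t)

      step : Fin (2 ^ n) → A → Fin (2 ^ n)
      step c a = encode (next? c a)

      K-law : ∀ c a w → K c (a ∷ w) ⇔ K (step c a) w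
      K-law c a w = mk⇔
        (λ (s , c∋s , l) → let t , s⟶t , l′ = Equivalence.to (law s a w) l in
          t , Equivalence.from (encode-∋ (next? c a) t) (s , c∋s , s⟶t) , l′)
        (λ (t , ∋t , l) → let s , c∋s , s⟶t = Equivalence.to (encode-∋ (next? c a) t) ∋t in
          s , c∋s , Equivalence.from (law s a w) (t , s⟶t , l))

-- Closure of the regular languages under Boolean and rational operations

module _ {A : Set} where

  regular-∁ : ∀ {L : Language A} → IsRegular L → IsRegular (∁ L)
  regular-∁ (M , L⊆M , M⊆L) = regular-resp-≐
    ((λ ¬l m → ¬l (M⊆L m)) , (λ ¬m l → ¬m (L⊆M l)))
    (regular-family (λ q → ∁ (accepts M q)) (DFA.step M) (λ q → ¬? (q ∈? DFA.final M))
      (λ _ _ _ → mk⇔ (λ x → x) (λ x → x)) (DFA.start M))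

  regular-Anything : IsRegular {A} Anything
  regular-Anything = regular-family {n = 1} (λ _ → Anything) (λ s _ → s) (λ _ → yes tt)
    (λ _ _ _ → mk⇔ (λ x → x) (λ x → x)) zero

  regular-[] : IsRegular {A} ｛ [] ｝
  regular-[] = regular-resp-≐ ((λ e → zero , tt , e) , (λ (_ , _ , e) → e))
    (regular-nfa (↔-refl {A = Fin 1}) (λ _ → ｛ [] ｝) {λ _ _ _ → ⊥} (λ _ _ _ → no λ ())
      (λ _ → yes refl) (λ _ _ _ → mk⇔ (λ ()) (λ ())) {λ _ → ⊤} (λ _ → yes tt))

  regular-letter : (∀ (a b : A) → Dec (a ≡ b)) → ∀ a → IsRegular ｛ a ∷ [] ｝
  regular-letter _≟_ a = regular-resp-≐
    ((λ e → zero , refl , e) , (λ { (_ , refl , e) → e }))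
    (regular-nfa (↔-refl {A = Fin 2}) L {_⟶[_]_} ⟶? ε? law {_≡ zero} (Fin._≟ zero))
    where
    L : Fin 2 → Language A
    L zero    = ｛ a ∷ [] ｝
    L (suc _) = ｛ [] ｝
    _⟶[_]_ : Fin 2 → A → Fin 2 → Set
    s ⟶[ b ] t = s ≡ zero × t ≡ suc zero × b ≡ a
    ⟶? : ∀ s b t → Dec (s ⟶[ b ] t)
    ⟶? s b t = s Fin.≟ zero ×-dec (t Fin.≟ suc zero ×-dec b ≟ a)
    ε? : ∀ s → Dec (L s [])
    ε? zero       = no λ ()
    ε? (suc zero) = yes refl
    law : ∀ s b w → L s (b ∷ w) ⇔ (∃ λ t → s ⟶[ b ] t × L t w)
    law zero       b w = mk⇔
      (λ { refl → suc zero , (refl , refl , refl) , refl })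
      (λ { (_ , (_ , refl , refl) , refl) → refl })
    law (suc zero) b w = mk⇔ (λ ()) (λ { (_ , (() , _) , _) })

  module _ {L₁ L₂ : Language A} (R₁ : IsRegular L₁) (R₂ : IsRegular L₂) where

    private
      M₁ = proj₁ R₁
      M₂ = proj₁ R₂
      module M₁ = DFA M₁
      module M₂ = DFA M₂

    regular-∪ : IsRegular (L₁ ∪ L₂)
    regular-∪ = regular-resp-≐
      ( (λ { (inj₁ l) → inj₁ _ , refl , proj₁ (proj₂ R₁) l
           ; (inj₂ l) → inj₂ _ , refl , proj₁ (proj₂ R₂) l })
      , (λ { (inj₁ _ , refl , m) → inj₁ (proj₂ (proj₂ R₁) m)
           ; (inj₂ _ , refl , m) → inj₂ (proj₂ (proj₂ R₂) m) }))
      (regular-nfa (↔-sym +↔⊎) L {_⟶[_]_} ⟶? ε? law {start} start?)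
      where
      L : Fin M₁.size ⊎ Fin M₂.size → Language A
      L (inj₁ p) = accepts M₁ p
      L (inj₂ q) = accepts M₂ q
      _⟶[_]_ : Fin M₁.size ⊎ Fin M₂.size → A → Fin M₁.size ⊎ Fin M₂.size → Set
      inj₁ p ⟶[ a ] inj₁ p′ = p′ ≡ M₁.step p a
      inj₂ q ⟶[ a ] inj₂ q′ = q′ ≡ M₂.step q a
      _      ⟶[ a ] _       = ⊥
      ⟶? : ∀ s a t → Dec (s ⟶[ a ] t)
      ⟶? (inj₁ p) a (inj₁ p′) = p′ Fin.≟ M₁.step p a
      ⟶? (inj₁ p) a (inj₂ q′) = no λ ()
      ⟶? (inj₂ q) a (inj₁ p′) = no λ ()
      ⟶? (inj₂ q) a (inj₂ q′) = q′ Fin.≟ M₂.step q a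
      ε? : ∀ s → Dec (L s [])
      ε? (inj₁ p) = p ∈? M₁.final
      ε? (inj₂ q) = q ∈? M₂.final
      law : ∀ s a w → L s (a ∷ w) ⇔ (∃ λ t → s ⟶[ a ] t × L t w)
      law (inj₁ p) a w = mk⇔ (λ m → inj₁ _ , refl , m) (λ { (inj₁ _ , refl , m) → m })
      law (inj₂ q) a w = mk⇔ (λ m → inj₂ _ , refl , m) (λ { (inj₂ _ , refl , m) → m })
      start : Fin M₁.size ⊎ Fin M₂.size → Set
      start (inj₁ p) = p ≡ M₁.start
      start (inj₂ q) = q ≡ M₂.start
      start? : Decidable start
      start? (inj₁ p) = p Fin.≟ M₁.start
      start? (inj₂ q) = q Fin.≟ M₂.start

    regular-· : IsRegular (L₁ · L₂)
    regular-· = regular-resp-≐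
      ( (λ (u , v , e , l₁ , l₂) → inj₁ _ , refl , u , v , e , proj₁ (proj₂ R₁) l₁ , proj₁ (proj₂ R₂) l₂)
      , (λ { (_ , refl , u , v , e , m₁ , m₂) → u , v , e , proj₂ (proj₂ R₁) m₁ , proj₂ (proj₂ R₂) m₂ }))
      (regular-nfa (↔-sym +↔⊎) L {_⟶[_]_} ⟶? ε? law {start} start?)
      where
      L : Fin M₁.size ⊎ Fin M₂.size → Language A
      L (inj₁ p) = accepts M₁ p · accepts M₂ M₂.start
      L (inj₂ q) = accepts M₂ q
      _⟶[_]_ : Fin M₁.size ⊎ Fin M₂.size → A → Fin M₁.size ⊎ Fin M₂.size → Set
      inj₁ p ⟶[ a ] inj₁ p′ = p′ ≡ M₁.step p a
      -- In place of an empty transition, the first letter of the second factor is read directly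
      -- from a final state of `M₁`.
      inj₁ p ⟶[ a ] inj₂ q′ = p Subset.∈ M₁.final × q′ ≡ M₂.step M₂.start a
      inj₂ q ⟶[ a ] inj₁ _  = ⊥
      inj₂ q ⟶[ a ] inj₂ q′ = q′ ≡ M₂.step q a
      ⟶? : ∀ s a t → Dec (s ⟶[ a ] t)
      ⟶? (inj₁ p) a (inj₁ p′) = p′ Fin.≟ M₁.step p a
      ⟶? (inj₁ p) a (inj₂ q′) = p ∈? M₁.final ×-dec q′ Fin.≟ M₂.step M₂.start a
      ⟶? (inj₂ q) a (inj₁ p′) = no λ ()
      ⟶? (inj₂ q) a (inj₂ q′) = q′ Fin.≟ M₂.step q a
      ε? : ∀ s → Dec (L s [])
      ε? (inj₁ p) = map′ (λ (m₁ , m₂) → [] , [] , refl , m₁ , m₂)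
        (λ { ([] , [] , _ , m₁ , m₂) → m₁ , m₂ }) (p ∈? M₁.final ×-dec M₂.start ∈? M₂.final)
      ε? (inj₂ q) = q ∈? M₂.final
      law : ∀ s a w → L s (a ∷ w) ⇔ (∃ λ t → s ⟶[ a ] t × L t w)
      law (inj₁ p) a w = mk⇔
        (λ { ([]    , _ , refl , m₁ , m₂) → inj₂ _ , (m₁ , refl) , m₂
           ; (_ ∷ u , v , refl , m₁ , m₂) → inj₁ _ , refl , u , v , refl , m₁ , m₂ })
        (λ { (inj₁ _ , refl , u , v , refl , m₁ , m₂) → a ∷ u , v , refl , m₁ , m₂
           ; (inj₂ _ , (m₁ , refl) , m₂) → [] , a ∷ w , refl , m₁ , m₂ })
      law (inj₂ q) a w = mk⇔ (λ m → inj₂ _ , refl , m) (λ { (inj₂ _ , refl , m) → m })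
      start : Fin M₁.size ⊎ Fin M₂.size → Set
      start s = s ≡ inj₁ M₁.start
      start? : Decidable start
      start? (inj₁ p) = map′ (cong inj₁) (λ { refl → refl }) (p Fin.≟ M₁.start)
      start? (inj₂ q) = no λ ()

  regular-｛_｝ : (∀ (a b : A) → Dec (a ≡ b)) → ∀ y → IsRegular ｛ y ｝
  regular-｛ _≟_ ｝ []      = regular-[]
  regular-｛ _≟_ ｝ (a ∷ y) = regular-resp-≐
    ( (λ { refl → a ∷ [] , y , refl , refl , refl })
    , (λ { (_ , _ , refl , refl , refl) → refl }))
    (regular-· (regular-letter _≟_ a) (regular-｛ _≟_ ｝ y))

  Star-[] : ∀ {L : Language A} → Star L []
  Star-[] = [] , [] , refl

  ⊆Star : ∀ {L : Language A} → L ⊆ Star L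
  ⊆Star {x = w} l = w ∷ [] , l ∷ [] , ++-identityʳ w

  Star-++ : ∀ {L : Language A} {u v} → Star L u → Star L v → Star L (u ++ v)
  Star-++ (xs , pxs , refl) (ys , pys , refl) = xs ++ ys , ++⁺ pxs pys , sym (concat-++ xs ys)

  -- `L` may contain the empty word, so empty factors in front are discarded until a factor supplies
  -- the letter `a`.
  Star-∷ : ∀ {L : Language A} {a w} → Star L (a ∷ w) →
           ∃₂ λ u v → w ≡ u ++ v × L (a ∷ u) × Star L v
  Star-∷ ([]      ∷ xs , _ ∷ pxs , e)    = Star-∷ (xs , pxs , e)
  Star-∷ ((_ ∷ u) ∷ xs , px ∷ pxs , refl) = u , concat xs , refl , px , xs , pxs , refl

  regular-Star : ∀ {L : Language A} → IsRegular L → IsRegular (Star L)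
  regular-Star {L} (M , L⊆M , M⊆L) = regular-resp-≐
    ( (λ { {[]} _ → inj₁ refl
         ; {a ∷ w} s → let u , v , e , l , s′ = Star-∷ s in
             inj₂ (_ , refl , a ∷ u , v , cong (a ∷_) e , L⊆M l , s′) })
    , (λ { (inj₁ refl) → Star-[]
         ; (inj₂ (_ , refl , u , v , refl , m , s)) → Star-++ (⊆Star (M⊆L m)) s }))
    -- The automaton below accepts only `L · Star L`; the empty product is added separately.
    (regular-∪ regular-[] (regular-nfa ↔-refl K {_⟶[_]_}
       (λ p a q → q Fin.≟ step p a ⊎-dec (p ∈? final ×-dec q Fin.≟ step start a))
       (λ q → map′ (λ m → [] , [] , refl , m , Star-[]) (λ { ([] , [] , _ , m , _) → m }) (q ∈? final))
       law {_≡ start} (Fin._≟ start)))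
    where
    open DFA M
    K : Fin size → Language A
    K q = accepts M q · Star L
    _⟶[_]_ : Fin size → A → Fin size → Set
    p ⟶[ a ] q = q ≡ step p a ⊎ (p Subset.∈ final × q ≡ step start a)
    law : ∀ q a w → K q (a ∷ w) ⇔ (∃ λ t → q ⟶[ a ] t × K t w)
    law q a w = mk⇔
      (λ { ([] , _ , refl , m , s) → let u , v , e , l , s′ = Star-∷ s in
             _ , inj₂ (m , refl) , u , v , e , L⊆M l , s′
         ; (_ ∷ u , v , refl , m , s) → _ , inj₁ refl , u , v , refl , m , s })
      (λ { (_ , inj₁ refl , u , v , refl , m , s) → a ∷ u , v , refl , m , s
         ; (_ , inj₂ (m , refl) , u , v , refl , m′ , s) →
             [] , a ∷ u ++ v , refl , m , Star-++ (⊆Star (M⊆L m′)) s })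

-- Decidability of emptiness

module _ {A : Set} {k : ℕ} (A↔k : A ↔ Fin k) where

  module _ {n : ℕ} (step : Fin n → A → Fin n) {P : Pred (Fin n) 0ℓ} (P? : Decidable P) where

    -- The pumping argument: among the states reached by the prefixes of lengths 0 to `n` two
    -- coincide, and the letters between them are cut out. This bounds the search for an accepted
    -- word.
    shorten : ∀ s w → Acc _<_ (length w) → P (foldl step s w) →
              ∃ λ w′ → length w′ ≤ n × P (foldl step s w′)
    shorten s w (acc rec) p with length w ≤? n
    ... | yes w≤n = w , w≤n , p
    ... | no  w≰n with pigeonhole ≤-refl (λ (i : Fin (suc n)) → foldl step s (take (toℕ i) w))
    ... | i , j , i<j , same = shorten s w′ (rec w′<w) (subst P same-end p)
      where
      w′ = take (toℕ i) w ++ drop (toℕ j) w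
      j≤w : toℕ j ≤ length w
      j≤w = ≤-trans (toℕ≤pred[n] j) (<⇒≤ (≰⇒> w≰n))
      w′<w : length w′ < length w
      w′<w = begin-strict
        length w′                                              ≡⟨ length-++ (take (toℕ i) w) ⟩
        length (take (toℕ i) w) + length (drop (toℕ j) w)
          ≡⟨ cong₂ _+_ (length-take (toℕ i) w) (length-drop (toℕ j) w) ⟩
        (toℕ i ⊓ length w) + (length w ∸ toℕ j)               ≤⟨ +-monoˡ-≤ _ (m⊓n≤m (toℕ i) (length w)) ⟩
        toℕ i + (length w ∸ toℕ j)                            <⟨ +-monoˡ-< _ i<j ⟩
        toℕ j + (length w ∸ toℕ j)                            ≡⟨ m+[n∸m]≡n j≤w ⟩
        length w                                               ∎
        where open ≤-Reasoning
      same-end : foldl step s w ≡ foldl step s w′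
      same-end = begin
        foldl step s w
          ≡⟨ cong (foldl step s) (take++drop≡id (toℕ j) w) ⟨
        foldl step s (take (toℕ j) w ++ drop (toℕ j) w)              ≡⟨ foldl-++ step s (take (toℕ j) w) _ ⟩
        foldl step (foldl step s (take (toℕ j) w)) (drop (toℕ j) w)
          ≡⟨ cong (λ t → foldl step t (drop (toℕ j) w)) same ⟨
        foldl step (foldl step s (take (toℕ i) w)) (drop (toℕ j) w)  ≡⟨ foldl-++ step s (take (toℕ i) w) _ ⟨
        foldl step s w′                                               ∎
        where open ≡-Reasoning

    search≤ : ∀ m s → Dec (∃ λ w → length w ≤ m × P (foldl step s w))
    search≤ zero    s = map′ (λ p → [] , z≤n , p) (λ { ([] , _ , p) → p }) (P? s)
    search≤ (suc m) s = map′
      (λ { (inj₁ p) → [] , z≤n , p ; (inj₂ (a , w , w≤m , p)) → a ∷ w , s≤s w≤m , p })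
      (λ { ([] , _ , p) → inj₁ p ; (a ∷ w , s≤s w≤m , p) → inj₂ (a , w , w≤m , p) })
      (P? s ⊎-dec any↔? A↔k (λ a → search≤ m (step s a)))

    search : ∀ s → Dec (∃ λ w → P (foldl step s w))
    search s = map′ (λ (w , _ , p) → w , p) (λ (w , p) → shorten s w (<-wellFounded _) p) (search≤ n s)

  nonempty? : ∀ {L : Language A} → IsRegular L → Dec (∃ L)
  nonempty? (M , L⊆M , M⊆L) = map′ (λ (w , m) → w , M⊆L m) (λ (w , l) → w , L⊆M l)
    (search (DFA.step M) (_∈? DFA.final M) (DFA.start M))

  regular-Prefixes : ∀ {L : Language A} → IsRegular L → IsRegular (Prefixes L)
  regular-Prefixes {L} (M , L⊆M , M⊆L) = regular-resp-≐
    ( (λ {w} (v , l) → v , subst (Subset._∈ final) (foldl-++ step start w v) (L⊆M l))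
    , (λ {w} (v , m) → v , M⊆L (subst (Subset._∈ final) (sym (foldl-++ step start w v)) m)))
    -- The final states are now those from which a final state can be reached, as `search` decides.
    (regular-family (λ q w → ∃ λ v → accepts M (foldl step q w) v) step
      (search step (_∈? final)) (λ _ _ _ → mk⇔ (λ x → x) (λ x → x)) start)
    where open DFA M

  regular-Suffixes : ∀ {L : Language A} → IsRegular L → IsRegular (Suffixes L)
  regular-Suffixes {L} (M , L⊆M , M⊆L) = regular-resp-≐
    ( (λ {w} (u , l) → foldl step start u , (u , refl) ,
         subst (Subset._∈ final) (foldl-++ step start u w) (L⊆M l))
    , (λ { {w} (_ , (u , refl) , m) → u , M⊆L (subst (Subset._∈ final) (sym (foldl-++ step start u w)) m) }))
    -- Every reachable state becomes initial, which makes the automaton nondeterministic.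
    (regular-nfa ↔-refl (accepts M) {λ p a q → q ≡ step p a} (λ p a q → q Fin.≟ step p a)
      (_∈? final) (λ p a w → mk⇔ (λ m → _ , refl , m) (λ { (_ , refl , m) → m }))
      {λ q → ∃ λ u → foldl step start u ≡ q}
      (λ q → search step (Fin._≟ q) start))
    where open DFA M

  regular-Factors : ∀ {L : Language A} → IsRegular L → IsRegular (Factors L)
  regular-Factors R = regular-resp-≐
    ((λ (u , v , l) → v , u , l) , (λ (v , u , l) → u , v , l))
    (regular-Prefixes (regular-Suffixes R))

  abstract
    -- The missing factors form a regular language, and its emptiness is decidable.
    factorial? : ∀ {L : Language A} → IsRegular L → (∀ w → Factors L w) ⊎ (∃ λ w → ¬ Factors L w)
    factorial? R with nonempty? (regular-∁ (regular-Factors R))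
    ... | yes missing = inj₂ missing
    ... | no  none    = inj₁ (λ w →
        decidable-stable (regular⇒decidable (regular-Factors R) w) (λ ¬f → none (w , ¬f)))

-- Unbordered words

module _ {A : Set} where

  Levi : (u v u′ v′ : Word A) → Set
  Levi u v u′ v′ = (∃ λ t → u′ ≡ u ++ t × v ≡ t ++ v′) ⊎ (∃ λ t → u ≡ u′ ++ t × v′ ≡ t ++ v)

  levi : ∀ (u v u′ v′ : Word A) → u ++ v ≡ u′ ++ v′ → Levi u v u′ v′
  levi []      v u′ v′ e = inj₁ (u′ , refl , e)
  levi (x ∷ u) v [] v′ e = inj₂ (x ∷ u , refl , sym e)
  levi (x ∷ u) v (x′ ∷ u′) v′ e with ∷-injective e
  ... | refl , e′ with levi u v u′ v′ e′
  ... | inj₁ (t , p , q) = inj₁ (t , cong (x ∷_) p , q)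
  ... | inj₂ (t , p , q) = inj₂ (t , cong (x ∷_) p , q)

  ++-injectiveˡ-length : ∀ (u v u′ v′ : Word A) → length u ≡ length u′ → u ++ v ≡ u′ ++ v′ → u ≡ u′
  ++-injectiveˡ-length []      v []        v′ _  _ = refl
  ++-injectiveˡ-length (x ∷ u) v (x′ ∷ u′) v′ l e with ∷-injective e
  ... | refl , e′ = cong (x ∷_) (++-injectiveˡ-length u v u′ v′ (suc-injective l) e′)

  length≡0 : ∀ {w : Word A} → length w ≡ 0 → w ≡ []
  length≡0 {[]} _ = refl

  -- The border is `r`. The first alternative makes it all of `y`, the second makes it empty.
  Unbordered : Word A → Set
  Unbordered y = ∀ t r q → y ≡ t ++ r → y ≡ r ++ q → t ≡ [] ⊎ r ≡ []

  Containing : Word A → Language A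
  Containing y = Anything · ｛ y ｝ · Anything

  containing : ∀ {y} u v → Containing y (u ++ y ++ v)
  containing {y} u v = u , y ++ v , refl , tt , y , v , refl , refl , tt

  -- A nonempty proper border starts with `a`. As a suffix it cannot start inside `v`, so it
  -- contains `v` and is at least as long as `a ∷ u`; as a prefix it then contains every `a` of the
  -- word. But the suffix misses the first `a`, so the numbers of letters `a` disagree.
  unbordered-++ : (∀ (a b : A) → Dec (a ≡ b)) → ∀ {a u v} → All (_≢ a) v → length (a ∷ u) ≤ length v →
                  Unbordered (a ∷ u ++ v)
  unbordered-++ _≟_ v∌a u≤v []      r q et er = inj₁ refl
  unbordered-++ _≟_ v∌a u≤v (x ∷ t) [] q et er = inj₂ refl
  unbordered-++ _≟_ {a} {u} {v} v∌a u≤v (x ∷ t) (z ∷ r) q et er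
    with ∷-injective et | ∷-injective er
  ... | refl , et′ | refl , er′ with levi u v t (z ∷ r) et′
  ... | inj₁ (s , _ , v≡) = contradiction refl (head≢ (++⁻ʳ s (subst (All _) v≡ v∌a)))
    where
    head≢ : ∀ {x w} → All (_≢ a) (x ∷ w) → x ≢ a
    head≢ (p ∷ _) = p
  ... | inj₂ (s , _ , zr≡) = contradiction (sym counts) (<⇒≢ more)
    where
    #a : Word A → ℕ
    #a w = length (filter (_≟ a) w)
    #a-++ : ∀ w w′ → #a (w ++ w′) ≡ #a w + #a w′
    #a-++ w w′ = trans (cong length (filter-++ (_≟ a) w w′)) (length-++ (filter (_≟ a) w))
    #a-∌ : ∀ {w} → All (_≢ a) w → #a w ≡ 0
    #a-∌ w∌a = cong length (filter-none (_≟ a) w∌a)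
    u≤r : length (a ∷ u) ≤ length (a ∷ r)
    u≤r = ≤-trans u≤v (≤-trans (m≤n+m _ (length s))
      (≤-reflexive (sym (trans (cong length zr≡) (length-++ s)))))
    q∌a : All (_≢ a) q
    q∌a with levi (a ∷ u) v (a ∷ r) q er
    ... | inj₁ (p , _ , v≡) = ++⁻ʳ p (subst (All _) v≡ v∌a)
    ... | inj₂ (p , u≡ , q≡) = subst (All _) (sym (trans q≡ (cong (_++ v) p≡[]))) v∌a
      where
      p≡[] : p ≡ []
      p≡[] = length≡0 (n≤0⇒n≡0 (+-cancelˡ-≤ (length (a ∷ r)) _ _ (≤-trans
        (≤-reflexive (trans (sym (length-++ (a ∷ r))) (cong length (sym u≡))))
        (≤-trans u≤r (≤-reflexive (sym (+-identityʳ _)))))))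
    counts : #a (a ∷ u ++ v) ≡ #a (a ∷ r)
    counts = trans (cong #a er) (trans (#a-++ (a ∷ r) q)
      (trans (cong (#a (a ∷ r) +_) (#a-∌ q∌a)) (+-identityʳ _)))
    more : #a (a ∷ r) < #a (a ∷ u ++ v)
    more = begin-strict
      #a (a ∷ r)
        <⟨ m<n+m _ (subst (0 <_) (sym (cong length (filter-accept (_≟ a) {xs = t} refl))) (s≤s z≤n)) ⟩
      #a (a ∷ t) + #a (a ∷ r)  ≡⟨ #a-++ (a ∷ t) (a ∷ r) ⟨
      #a (a ∷ t ++ a ∷ r)      ≡⟨ cong #a et ⟨
      #a (a ∷ u ++ v)          ∎
      where open ≤-Reasoning

  module Synchronisation {y : Word A} (unbordered : Unbordered y) where

    private
      -- Here `t` is the distance between two occurrences of `y`. If it were at least the length of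
      -- `y`, the first occurrence would lie inside `p′`; otherwise the overlap is a nonempty
      -- border, hence all of `y`.
      no-overlap : ∀ {p p′ t s s′} → ¬ Containing y p′ → p′ ≡ p ++ t → y ++ s ≡ t ++ y ++ s′ → t ≡ []
      no-overlap {p} {p′} {t} {s} {s′} free p′≡ e with levi y s t (y ++ s′) e
      ... | inj₁ (r , t≡ , _) =
        contradiction (subst (Containing y) (sym (trans p′≡ (cong (p ++_) t≡))) (containing p r)) free
      ... | inj₂ (r , y≡ , e′) with levi y s′ r s e′
      ... | inj₁ (q , r≡ , _) = length≡0 (m+n≡0⇒m≡0 (length t) (+-cancelʳ-≡ (length y) _ 0 (sym (begin
          length y                              ≡⟨ cong length (trans y≡ (cong (t ++_) r≡)) ⟩
          length (t ++ y ++ q)                  ≡⟨ trans (length-++ t) (cong (length t +_) (length-++ y)) ⟩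
          length t + (length y + length q)      ≡⟨ cong (length t +_) (+-comm (length y) _) ⟩
          length t + (length q + length y)      ≡⟨ +-assoc (length t) _ _ ⟨
          length t + length q + length y        ∎))))
        where open ≡-Reasoning
      ... | inj₂ (q , y≡r , _) with unbordered t r q y≡ y≡r
      ... | inj₁ t≡[] = t≡[]
      ... | inj₂ refl = contradiction (subst (Containing y) (sym p′≡y) (containing p [])) free
        where
        p′≡y : p′ ≡ p ++ y ++ []
        p′≡y = trans p′≡ (cong (p ++_) (sym (trans (++-identityʳ y) (trans y≡ (++-identityʳ t)))))

    -- The longer of the two stretches extends the shorter by some `t`, and `no-overlap` makes `t`
    -- empty.
    synchronise : ∀ {p p′ s s′} → ¬ Containing y p → ¬ Containing y p′ →
                  p ++ y ++ s ≡ p′ ++ y ++ s′ → p ≡ p′ × s ≡ s′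
    synchronise {p} {p′} {s} {s′} free free′ e with levi p (y ++ s) p′ (y ++ s′) e
    ... | inj₁ (t , p′≡ , e′) with no-overlap {p} {t = t} free′ p′≡ e′
    ... | refl = sym (trans p′≡ (++-identityʳ p)) , ++-cancelˡ y _ _ e′
    synchronise {p} {p′} {s} {s′} free free′ e
        | inj₂ (t , p≡ , e′) with no-overlap {p′} {t = t} free p≡ e′
    ... | refl = trans p≡ (++-identityʳ p′) , sym (++-cancelˡ y _ _ e′)

-- The completion of a code by an unbordered word that is not a factor

module Completion {A : Set} (_≟_ : ∀ (a b : A) → Dec (a ≡ b))
  (X : Language A) (regular-X : IsRegular X) (code-X : IsCode X)
  {y : Word A} (y≢[] : y ≢ []) (unbordered : Unbordered y) (y∉ : ¬ Factors (Star X) y) where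

  open Synchronisation unbordered

  -- A stretch in `Star X` between two occurrences of `y` can already be read as words of `X`
  -- between two words of `Y`; allowing it as a gap would give a second reading.
  Gap : Language A
  Gap = ∁ (Star X ∪ Containing y)

  Y : Language A
  Y = ｛ y ｝ · Star (Gap · ｛ y ｝)

  Z : Language A
  Z = X ∪ Y

  regular-Containing : IsRegular (Containing y)
  regular-Containing = regular-· regular-Anything (regular-· (regular-｛ _≟_ ｝ y) regular-Anything)

  abstract
    regular-Z : IsRegular Z
    regular-Z = regular-∪ regular-X (regular-· (regular-｛ _≟_ ｝ y) (regular-Star (regular-·
      (regular-∁ (regular-∪ (regular-Star regular-X) regular-Containing)) (regular-｛ _≟_ ｝ y))))

    containing? : Decidable (Containing y)
    containing? = regular⇒decidable regular-Containing

    star? : Decidable (Star X)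
    star? = regular⇒decidable (regular-Star regular-X)

  -- Unique factorisation over `Z`

  Star⇒free : ∀ {w} → Star X w → ¬ Containing y w
  Star⇒free s (u , _ , refl , _ , _ , v , refl , refl , _) = y∉ (u , v , s)

  Gap⇒free : ∀ {w} → Gap w → ¬ Containing y w
  Gap⇒free g c = g (inj₂ c)

  -- Groups a product over `Z` by its words of `Y`, each opened into `y` and a list of gaps closed
  -- by `y`. The stretch before the next `y` is thus explicit, in the form that `synchronise`
  -- compares.
  data Parsed : List (Word A) → Set where
    unmarked : ∀ {xs} → All X xs → Parsed xs
    marked   : ∀ {xs gs zs} → All X xs → All (Gap · ｛ y ｝) gs → Parsed zs →
               Parsed (xs ++ (y ++ concat gs) ∷ zs)

  parse : ∀ {zs} → All Z zs → Parsed zs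
  parse [] = unmarked []
  parse (inj₁ x ∷ pzs) with parse pzs
  ... | unmarked pxs        = unmarked (x ∷ pxs)
  ... | marked pxs pgs zs   = marked (x ∷ pxs) pgs zs
  parse (inj₂ (_ , _ , refl , refl , gs , pgs , refl) ∷ pzs) = marked [] pgs (parse pzs)

  concat-marked : ∀ xs gs zs → concat (xs ++ (y ++ concat gs) ∷ zs) ≡ concat xs ++ y ++ concat gs ++ concat zs
  concat-marked xs gs zs = trans (sym (concat-++ xs _))
    (cong (concat xs ++_) (++-assoc y (concat gs) (concat zs)))

  X*-free : ∀ {xs} → All X xs → ¬ Containing y (concat xs)
  X*-free pxs = Star⇒free (_ , pxs , refl)

  unmarked≢marked : ∀ {xs} → All X xs → ∀ p s → concat xs ≢ p ++ y ++ s
  unmarked≢marked pxs p s e = X*-free pxs (subst (Containing y) (sym e) (containing p s))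

  assoc-gap : ∀ u gs zs → concat ((u ++ y) ∷ gs) ++ concat zs ≡ u ++ y ++ concat gs ++ concat zs
  assoc-gap u gs zs = trans (++-assoc (u ++ y) (concat gs) _) (++-assoc u y _)

  Gap≢marked : ∀ {u p s t} → Gap u → ¬ Containing y p → Star X p → u ++ y ++ s ≢ p ++ y ++ t
  Gap≢marked g free p* e with synchronise (Gap⇒free g) free e
  ... | refl , _ = g (inj₁ p*)

  -- Two readings cannot disagree about where a word of `Y` ends. The reading that has ended it sees
  -- no further `y`, or a product of words of `X` before the next one; the other sees the gap `u`
  -- there.
  gap≢parsed : ∀ {u gs zs zs′} → Gap u → Parsed zs → concat zs ≢ concat ((u ++ y) ∷ gs) ++ concat zs′
  gap≢parsed {u} {gs} {zs′ = zs′} g (unmarked pxs) e =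
    unmarked≢marked pxs u (concat gs ++ concat zs′) (trans e (assoc-gap u gs zs′))
  gap≢parsed {u} {gs} {zs′ = zs′} g (marked {xs} {gs₁} {zs} pxs _ _) e =
    Gap≢marked g (X*-free pxs) (_ , pxs , refl)
      (trans (sym (assoc-gap u gs zs′)) (trans (sym e) (concat-marked xs gs₁ zs)))

  -- Mutual induction along the occurrences of `y`: `parsed-unique` stands between two words of `Z`,
  -- `gaps-unique` just after a `y` of a word of `Y`. Each use of `synchronise` removes the stretch
  -- up to the next `y`, and `code-X` factors the stretches in `Star X`.
  parsed-unique : ∀ {zs zs′} → Parsed zs → Parsed zs′ → concat zs ≡ concat zs′ → zs ≡ zs′
  gaps-unique   : ∀ {gs gs′ zs zs′} → All (Gap · ｛ y ｝) gs → All (Gap · ｛ y ｝) gs′ → Parsed zs → Parsed zs′ →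
                  concat gs ++ concat zs ≡ concat gs′ ++ concat zs′ → gs ≡ gs′ × zs ≡ zs′

  parsed-unique (unmarked pxs) (unmarked pxs′) e = code-X _ _ pxs pxs′ e
  parsed-unique (unmarked pxs) (marked {xs} {gs} {zs} _ _ _) e =
    contradiction (trans e (concat-marked xs gs zs))
      (unmarked≢marked pxs (concat xs) (concat gs ++ concat zs))
  parsed-unique (marked {xs} {gs} {zs} _ _ _) (unmarked pxs) e =
    contradiction (trans (sym e) (concat-marked xs gs zs))
      (unmarked≢marked pxs (concat xs) (concat gs ++ concat zs))
  parsed-unique (marked {xs} {gs} {zs} pxs pgs p) (marked {xs′} {gs′} {zs′} pxs′ pgs′ p′) e
    with synchronise (X*-free pxs) (X*-free pxs′)
           (trans (sym (concat-marked xs gs zs)) (trans e (concat-marked xs′ gs′ zs′)))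
  ... | exs , e′ with code-X xs xs′ pxs pxs′ exs | gaps-unique pgs pgs′ p p′ e′
  ... | refl | refl , refl = refl

  gaps-unique [] [] p p′ e = refl , parsed-unique p p′ e
  gaps-unique {zs′ = zs′} [] (_∷_ {xs = gs} (u , _ , refl , g , refl) pgs) p p′ e =
    contradiction e (gap≢parsed {u} {gs} {zs′ = zs′} g p)
  gaps-unique {zs = zs} (_∷_ {xs = gs} (u , _ , refl , g , refl) pgs) [] p p′ e =
    contradiction (sym e) (gap≢parsed {u} {gs} {zs′ = zs} g p′)
  gaps-unique {zs = zs} {zs′} (_∷_ {xs = gs} (u , _ , refl , g , refl) pgs)
    (_∷_ {xs = gs′} (u′ , _ , refl , g′ , refl) pgs′) p p′ e
    with synchronise (Gap⇒free g) (Gap⇒free g′)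
           (trans (sym (assoc-gap u gs zs)) (trans e (assoc-gap u′ gs′ zs′)))
  ... | refl , e′ with gaps-unique pgs pgs′ p p′ e′
  ... | refl , refl = refl , refl

  code-Z : IsCode Z
  code-Z zs zs′ pzs pzs′ = parsed-unique (parse pzs) (parse pzs′)

  -- Completeness of `Z`

  y∈Y : Y y
  y∈Y = y , [] , sym (++-identityʳ y) , refl , Star-[]

  FirstOccurrence : Word A → Set
  FirstOccurrence w = ∃₂ λ p s → w ≡ p ++ y ++ s × ¬ Containing y p

  length-y : 0 < length y
  length-y = nonzero y≢[]
    where
    nonzero : ∀ {w : Word A} → w ≢ [] → 0 < length w
    nonzero {[]}    w≢[] = contradiction refl w≢[]
    nonzero {_ ∷ _} _    = s≤s z≤n

  -- While the stretch before `y` still contains `y`, an occurrence inside it replaces the current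
  -- one; the stretch gets shorter because `y` is nonempty.
  containing⇒first : ∀ {w} → Containing y w → FirstOccurrence w
  containing⇒first (u , _ , refl , _ , _ , v , refl , refl , _) = go u v (<-wellFounded _)
    where
    go : ∀ p s → Acc _<_ (length p) → FirstOccurrence (p ++ y ++ s)
    go p s (acc rec) with containing? p
    ... | no free = p , s , refl , free
    ... | yes (p′ , _ , refl , _ , _ , s′ , refl , refl , _) =
      subst FirstOccurrence
        (sym (trans (++-assoc p′ (y ++ s′) (y ++ s)) (cong (p′ ++_) (++-assoc y s′ (y ++ s)))))
        (go p′ (s′ ++ y ++ s) (rec
          (≤-trans (m<m+n (length p′) (≤-trans length-y (length-++-≤ˡ y))) (≤-reflexive (sym (length-++ p′))))))

  -- A y-free stretch before an occurrence of y either extends the following word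
  -- of Y, or is a product of words of X and separates it from the word y of Y.
  framed : ∀ w → Acc _<_ (length w) → (Y · Star Z) (y ++ w ++ y)
  framed w (acc rec) with containing? w
  framed w (acc rec) | no free with star? w
  ... | yes (xs , pxs , refl) =
    y , concat xs ++ y , refl , y∈Y ,
    Star-++ (xs , All.map inj₁ pxs , refl) (⊆Star (inj₂ y∈Y))
  -- Here `w` itself is a gap, so the framed word is a single word of `Y`.
  ... | no ¬star =
    y ++ w ++ y , [] , sym (++-identityʳ _) , (y , w ++ y , refl , refl ,
      ⊆Star (w , y , refl , [ ¬star , free ] , refl)) , Star-[]
  framed w (acc rec) | yes c with containing⇒first c
  ... | p , s , refl , free with framed s (rec shorter) | star? p
    where
    shorter : length s < length (p ++ y ++ s)
    shorter = begin-strict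
      length s                        <⟨ m<n+m _ length-y ⟩
      length y + length s             ≡⟨ length-++ y ⟨
      length (y ++ s)                 ≤⟨ length-++-≤ʳ (y ++ s) {p} ⟩
      length (p ++ y ++ s)            ∎
      where open ≤-Reasoning
  ... | t , r , e , t∈Y , r∈Z* | yes (xs , pxs , refl) =
    y , concat xs ++ t ++ r , cong (y ++_) e′ , y∈Y ,
    Star-++ (xs , All.map inj₁ pxs , refl) (Star-++ (⊆Star (inj₂ t∈Y)) r∈Z*)
    where
    e′ : (concat xs ++ y ++ s) ++ y ≡ concat xs ++ t ++ r
    e′ = trans (++-assoc (concat xs) (y ++ s) y) (cong (concat xs ++_) (trans (++-assoc y s y) e))
  -- The leading `y` of `t` closes the gap `p`, so `t` extended to the left by `y ++ p` is still in
  -- `Y`.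
  ... | t , r , e , (_ , v , refl , refl , v∈*) , r∈Z* | no ¬star =
    y ++ (p ++ y) ++ v , r , e′ , (y , (p ++ y) ++ v , refl , refl ,
      Star-++ (⊆Star (p , y , refl , [ ¬star , free ] , refl)) v∈*) , r∈Z*
    where
    e′ : y ++ (p ++ y ++ s) ++ y ≡ (y ++ (p ++ y) ++ v) ++ r
    e′ = begin
      y ++ (p ++ y ++ s) ++ y      ≡⟨ cong (y ++_) (++-assoc p (y ++ s) y) ⟩
      y ++ p ++ (y ++ s) ++ y      ≡⟨ cong (λ z → y ++ p ++ z) (trans (++-assoc y s y) e) ⟩
      y ++ p ++ (y ++ v) ++ r      ≡⟨ cong (y ++_) (++-assoc p (y ++ v) r) ⟨
      y ++ (p ++ y ++ v) ++ r      ≡⟨ ++-assoc y (p ++ y ++ v) r ⟨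
      (y ++ p ++ y ++ v) ++ r      ≡⟨ cong (λ z → (y ++ z) ++ r) (++-assoc p y v) ⟨
      (y ++ (p ++ y) ++ v) ++ r    ∎
      where open ≡-Reasoning

  -- Framing by `y` puts every stretch of `w`, also the first and the last, between two occurrences
  -- of `y`.
  Z*-factorial : ∀ w → Factors (Star Z) w
  Z*-factorial w with framed w (<-wellFounded _)
  ... | t , r , e , t∈Y , r∈Z* = y , y , subst (Star Z) (sym e) (Star-++ (⊆Star (inj₂ t∈Y)) r∈Z*)

  Y-prefix : ∀ {z} → Y z → ∃ λ v → z ≡ y ++ v
  Y-prefix (_ , v , e , refl , _) = v , e

  Y-suffix : ∀ {z} → Y z → ∃ λ v → z ≡ v ++ y
  Y-suffix (_ , _ , refl , refl , gs , pgs , refl) = go pgs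
    where
    go : ∀ {gs} → All (Gap · ｛ y ｝) gs → ∃ λ v → y ++ concat gs ≡ v ++ y
    go [] = [] , ++-identityʳ y
    go (_∷_ {xs = gs} (u , _ , refl , _ , refl) pgs) with go pgs
    ... | v , e = y ++ u ++ v , (begin
      y ++ (u ++ y) ++ concat gs    ≡⟨ cong (y ++_) (++-assoc u y (concat gs)) ⟩
      y ++ u ++ y ++ concat gs      ≡⟨ cong (λ z → y ++ u ++ z) e ⟩
      y ++ u ++ v ++ y              ≡⟨ cong (y ++_) (++-assoc u v y) ⟨
      y ++ (u ++ v) ++ y            ≡⟨ ++-assoc y (u ++ v) y ⟨
      (y ++ u ++ v) ++ y            ∎)
      where open ≡-Reasoning

factorial⇒complete : ∀ {A : Set} {L : Language A} → (∀ w → Factors (Star L) w) → IsComplete L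
factorial⇒complete all w with all w
... | u , v , s = u ++ w ++ v , s , fromView (MkView u (Pointwise.refl refl) v)

-- Automorphisms and antiautomorphisms

module _ {A : Set} where

  infix 4 _⊑_

  _⊑_ : Word A → Word A → Set
  u ⊑ w = ∃₂ λ p s → w ≡ p ++ u ++ s

  ⊑-trans : ∀ {u v w} → u ⊑ v → v ⊑ w → u ⊑ w
  ⊑-trans {u} (p , s , refl) (p′ , s′ , refl) = p′ ++ p , s ++ s′ , (begin
    p′ ++ (p ++ u ++ s) ++ s′    ≡⟨ cong (p′ ++_) (++-assoc p (u ++ s) s′) ⟩
    p′ ++ p ++ (u ++ s) ++ s′    ≡⟨ cong (λ z → p′ ++ p ++ z) (++-assoc u s s′) ⟩
    p′ ++ p ++ u ++ s ++ s′      ≡⟨ ++-assoc p′ p _ ⟨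
    (p′ ++ p) ++ u ++ s ++ s′    ∎)
    where open ≡-Reasoning

  IsHomo IsAntiHomo : (Word A → Word A) → Set
  IsHomo     θ = ∀ u v → θ (u ++ v) ≡ θ u ++ θ v
  IsAntiHomo θ = ∀ u v → θ (u ++ v) ≡ θ v ++ θ u

  length≡1 : ∀ (w : Word A) → length w ≡ 1 → ∃ λ a → w ≡ a ∷ []
  length≡1 (a ∷ []) _ = a , refl

  module _ {θ : Word A → Word A} (homo : IsHomo θ ⊎ IsAntiHomo θ)
           (injective : Injective _≡_ _≡_ θ) (surjective : ∀ w → ∃ λ v → θ v ≡ w) where

    θ-[] : θ [] ≡ []
    θ-[] = ++-identityʳ-unique (θ []) ([ (λ h → h [] []) , (λ h → h [] []) ]′ homo)

    length-θ-++ : ∀ u v → length (θ (u ++ v)) ≡ length (θ u) + length (θ v)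
    length-θ-++ u v =
      [ (λ h → trans (cong length (h u v)) (length-++ (θ u)))
      , (λ h → trans (cong length (h u v)) (trans (length-++ (θ v)) (+-comm (length (θ v)) _)))
      ]′ homo

    θ-nonempty : ∀ {w} → w ≢ [] → 0 < length (θ w)
    θ-nonempty {w} w≢[] with θ w in e
    ... | []    = contradiction (injective (trans e (sym θ-[]))) w≢[]
    ... | _ ∷ _ = s≤s z≤n

    -- By injectivity no letter has an empty image, so each contributes at least one letter.
    length-θ-≥ : ∀ w → length w ≤ length (θ w)
    length-θ-≥ []      = z≤n
    length-θ-≥ (a ∷ w) = ≤-trans (+-mono-≤ (θ-nonempty {a ∷ []} λ ()) (length-θ-≥ w))
                           (≤-reflexive (sym (length-θ-++ (a ∷ []) w)))

    preimage-++ : ∀ {w u′ v′} → θ w ≡ u′ ++ v′ →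
                  ∃₂ λ u v → θ u ≡ u′ × θ v ≡ v′ × (w ≡ u ++ v ⊎ w ≡ v ++ u)
    preimage-++ {w} {u′} {v′} e with surjective u′ | surjective v′
    ... | u , refl | v , refl = u , v , refl , refl ,
      [ (λ h → inj₁ (injective (trans e (sym (h u v)))))
      , (λ h → inj₂ (injective (trans e (sym (h v u))))) ]′ homo

    -- The same count for the inverse of `θ`: the letters of `v` have nonempty preimages, whose
    -- product in one order or the other is `w`.
    length-θ-≤ : ∀ w v → θ w ≡ v → length v ≤ length w
    length-θ-≤ w []      e = z≤n
    length-θ-≤ w (a ∷ v) e with preimage-++ {u′ = a ∷ []} e
    ... | [] , _ , θu≡ , _ = contradiction (trans (sym θ-[]) θu≡) (λ ())
    ... | u@(_ ∷ _) , x , _ , θx≡ , inj₁ refl = ≤-trans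
      (+-mono-≤ (s≤s z≤n) (length-θ-≤ x v θx≡)) (≤-reflexive (sym (length-++ u)))
    ... | u@(_ ∷ _) , x , _ , θx≡ , inj₂ refl = ≤-trans
      (+-mono-≤ (s≤s z≤n) (length-θ-≤ x v θx≡))
      (≤-reflexive (sym (trans (length-++ x) (+-comm (length x) _))))

    length-θ : ∀ w → length (θ w) ≡ length w
    length-θ w = ≤-antisym (length-θ-≤ w (θ w) refl) (length-θ-≥ w)

    θ-letter : ∀ a → ∃ λ c → θ (a ∷ []) ≡ c ∷ []
    θ-letter a = length≡1 _ (length-θ (a ∷ []))

    θ-⊑ : ∀ {u w} → u ⊑ w → θ u ⊑ θ w
    θ-⊑ {u} (p , s , refl) =
      [ (λ h → θ p , θ s , trans (h p _) (cong (θ p ++_) (h u s)))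
      , (λ h → θ s , θ p , trans (h p _) (trans (cong (_++ θ p) (h u s)) (++-assoc (θ s) (θ u) (θ p))))
      ]′ homo

    θ-⊑⁻¹ : ∀ {u w} → θ u ⊑ θ w → u ⊑ w
    θ-⊑⁻¹ {u} {w} (p , s , e) with surjective p | surjective s
    ... | p′ , refl | s′ , refl =
      [ (λ h → p′ , s′ , injective (trans e (sym (trans (h p′ _) (cong (θ p′ ++_) (h u s′))))))
      , (λ h → s′ , p′ , injective (trans e (sym
          (trans (h s′ _) (trans (cong (_++ θ s′) (h u p′)) (++-assoc (θ p′) (θ u) (θ s′)))))))
      ]′ homo

    -- `θ z` starts with `θ y`: for a homomorphism because `y` is a prefix of `z`, for an
    -- antihomomorphism because it is a suffix. Since `θ` preserves length, this prefix is `y`.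
    θ-fixes-border : ∀ {y z} → (∃ λ v → z ≡ y ++ v) → (∃ λ v → z ≡ v ++ y) → (∃ λ v → θ z ≡ y ++ v) → θ y ≡ y
    θ-fixes-border {y} (v , e₁) (v′ , e₂) (v″ , e) =
      [ (λ h → ++-injectiveˡ-length (θ y) (θ v) y v″ (length-θ y) (trans (sym (trans (cong θ e₁) (h y v))) e))
      , (λ h → ++-injectiveˡ-length (θ y) (θ v′) y v″ (length-θ y) (trans (sym (trans (cong θ e₂) (h v′ y))) e))
      ]′ homo

    -- y₀ and y₁ are chosen so that neither θ nor its inverse maps a word of X
    -- to a word containing y.
    independent-∪ : ∀ {X Y : Language A} {y y₀ y₁ : Word A} →
      Independent (Underline θ) X →
      ((∀ w → θ w ≡ w) ⊎ θ y ≢ y) →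
      (∀ {z} → Y z → ∃ λ v → z ≡ y ++ v) → (∀ {z} → Y z → ∃ λ v → z ≡ v ++ y) →
      θ y₁ ≡ y₀ → θ y₀ ⊑ y → y₁ ⊑ y → (∀ {x} → X x → ¬ y₀ ⊑ x) →
      Independent (Underline θ) (X ∪ Y)
    -- For the identity the relation `Underline θ` is empty.
    independent-∪ ind (inj₁ θ≡id) _ _ _ _ _ _ ((w , _ , _ , moved) , _) = moved (θ≡id w)
    independent-∪ {X} {Y} {y} {y₀} {y₁} ind (inj₂ moves) prefix suffix
        refl θy₀⊑y y₁⊑y y₀⋢ ((z , z∈ , refl , moved) , θz∈) = go z∈ θz∈
      where
      y⊑ : ∀ {w} → Y w → y ⊑ w
      y⊑ w∈Y with prefix w∈Y
      ... | v , e = [] , v , e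
      go : (X ∪ Y) z → (X ∪ Y) (θ z) → ⊥
      go (inj₁ z∈X) (inj₁ θz∈X) = ind ((z , z∈X , refl , moved) , θz∈X)
      -- `θ z` contains `y`, hence `θ y₀`, and factors pull back along `θ`.
      go (inj₁ z∈X) (inj₂ θz∈Y) = y₀⋢ z∈X (θ-⊑⁻¹ (⊑-trans θy₀⊑y (y⊑ θz∈Y)))
      -- `z` contains `y₁`, so `θ z` contains `θ y₁`, which is `y₀`.
      go (inj₂ z∈Y) (inj₁ θz∈X) = y₀⋢ θz∈X (θ-⊑ (⊑-trans y₁⊑y (y⊑ z∈Y)))
      go (inj₂ z∈Y) (inj₂ θz∈Y) = moves (θ-fixes-border (prefix z∈Y) (suffix z∈Y) (prefix θz∈Y))

  -- The two final letters b force an antiautomorphism to map a marker to a word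
  -- starting with a square.
  marker : A → A → Word A → Word A
  marker a b w = a ∷ (b ∷ w) ++ replicate (length w) b ++ b ∷ b ∷ []

  ⊑-marker : ∀ a b {u w} → u ⊑ w → u ⊑ marker a b w
  ⊑-marker a b {w = w} u⊑w = ⊑-trans u⊑w (a ∷ b ∷ [] , replicate (length w) b ++ b ∷ b ∷ [] , refl)

  unbordered-marker : (∀ (a b : A) → Dec (a ≡ b)) → ∀ {a b} → b ≢ a → ∀ w → Unbordered (marker a b w)
  unbordered-marker _≟_ {b = b} b≢a w = unbordered-++ _≟_ {u = b ∷ w}
    (++⁺ (replicate⁺ (length w) b≢a) (b≢a ∷ b≢a ∷ []))
    -- The length condition holds with equality: both halves have `length w + 2` letters.
    (≤-reflexive (sym (trans (length-++ (replicate (length w) _))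
      (trans (cong (_+ 2) (length-replicate (length w))) (+-comm (length w) 2)))))

  module _ {θ : Word A → Word A} (injective : Injective _≡_ _≡_ θ) (surjective : ∀ w → ∃ λ v → θ v ≡ w) where

    homo⇒marker-moves : IsHomo θ → ∀ {a} → θ (a ∷ []) ≢ a ∷ [] → ∀ b w → θ (marker a b w) ≢ marker a b w
    homo⇒marker-moves h {a} moved b w e with θ-letter (inj₁ h) injective surjective a
    ... | c , θa≡ with ∷-injective (trans (sym (trans (h (a ∷ []) _) (cong (_++ θ (b ∷ w ++ _)) θa≡))) e)
    ... | refl , _ = moved θa≡

    -- The marker starts with the two different letters `a` and `b`, its image with the image of `b`
    -- twice.
    antihomo⇒marker-moves : IsAntiHomo θ → ∀ {a b} → b ≢ a → ∀ w → θ (marker a b w) ≢ marker a b w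
    antihomo⇒marker-moves h {a} {b} b≢a w e with θ-letter (inj₂ h) injective surjective b
    ... | c , θb≡ = b≢a (trans (sym b≡c) c≡a)
      where
      rest = a ∷ b ∷ w ++ replicate (length w) b
      θmarker : θ (marker a b w) ≡ c ∷ c ∷ θ rest
      θmarker = begin
        θ (marker a b w)
          ≡⟨ cong (λ z → θ (a ∷ b ∷ z)) (++-assoc w (replicate (length w) b) _) ⟨
        θ (rest ++ b ∷ b ∷ [])                        ≡⟨ h rest (b ∷ b ∷ []) ⟩
        θ (b ∷ b ∷ []) ++ θ rest                      ≡⟨ cong (_++ θ rest) (h (b ∷ []) (b ∷ [])) ⟩
        (θ (b ∷ []) ++ θ (b ∷ [])) ++ θ rest          ≡⟨ cong (λ z → (z ++ z) ++ θ rest) θb≡ ⟩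
        c ∷ c ∷ θ rest                                ∎
        where open ≡-Reasoning
      c≡a : c ≡ a
      c≡a = proj₁ (∷-injective (trans (sym θmarker) e))
      b≡c : c ≡ b
      b≡c = proj₁ (∷-injective (proj₂ (∷-injective (trans (sym θmarker) e))))

  homo-identity : ∀ {θ : Word A → Word A} → IsHomo θ → (∀ a → θ (a ∷ []) ≡ a ∷ []) → ∀ w → θ w ≡ w
  homo-identity {θ} h fixed []      = ++-identityʳ-unique (θ []) (h [] [])
  homo-identity {θ} h fixed (a ∷ w) = trans (h (a ∷ []) w) (cong₂ _++_ (fixed a) (homo-identity h fixed w))

-- Choice of the letters and assembly of the completion

another-letter : ∀ {A : Set} {k : ℕ} → A ↔ Fin k → 2 ≤ k → ∀ a → ∃ λ (b : A) → b ≢ a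
another-letter A↔k (s≤s (s≤s _)) a with Inverse.to A↔k a in e
... | zero  = Inverse.from A↔k (suc zero) , λ e′ →
  contradiction (trans (sym (Inverse.inverseˡ A↔k (sym e′))) e) (λ ())
... | suc _ = Inverse.from A↔k zero , λ e′ →
  contradiction (trans (sym (Inverse.inverseˡ A↔k (sym e′))) e) (λ ())

module _ {A : Set} {k : ℕ} (A↔k : A ↔ Fin k) (2≤k : 2 ≤ k) where

  letter≟ : ∀ (a b : A) → Dec (a ≡ b)
  letter≟ = via-injection (↔⇒↣ A↔k) Fin._≟_

  some-letter : A
  some-letter = Inverse.from A↔k (fromℕ< (≤-trans (s≤s z≤n) 2≤k))

  module _ {θ : Word A → Word A} (homo : IsHomo θ ⊎ IsAntiHomo θ)
           (injective : Injective _≡_ _≡_ θ) (surjective : ∀ w → ∃ λ v → θ v ≡ w) where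

    -- A letter moved by `θ` serves as `a` in both cases. If there is none, a homomorphism is the
    -- identity, and for an antihomomorphism any two distinct letters will do.
    moving-letters : ∃₂ λ a b → b ≢ a × (∀ w → (∀ v → θ v ≡ v) ⊎ θ (marker a b w) ≢ marker a b w)
    moving-letters with any↔? A↔k (λ a → ¬? (≡-dec letter≟ (θ (a ∷ [])) (a ∷ [])))
    ... | yes (a , moved) = let b , b≢a = another-letter A↔k 2≤k a in
      a , b , b≢a , λ w → inj₂
        ([ (λ h → homo⇒marker-moves injective surjective h moved b w)
         , (λ h → antihomo⇒marker-moves injective surjective h b≢a w) ]′ homo)
    ... | no ¬moved = let b , b≢a = another-letter A↔k 2≤k some-letter in
      some-letter , b , b≢a , λ w →
        [ (λ h → inj₁ (homo-identity h (λ a →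
            decidable-stable (≡-dec letter≟ (θ (a ∷ [])) (a ∷ [])) (λ moved → ¬moved (a , moved)))))
        , (λ h → inj₂ (antihomo⇒marker-moves injective surjective h b≢a w)) ]′ homo

    completion : ∀ (X : Language A) → IsRegular X → Independent (Underline θ) X → IsCode X →
      ∃[ Z ] (IsRegular Z × Independent (Underline θ) Z × IsCode Z × IsComplete Z × X ⊆ Z)
    completion X regular-X independent-X code-X =
      [ (λ factorial →
           -- If every word is a factor of `Star X`, then `X` is its own completion.
           X , regular-X , (λ {_} → independent-X) , code-X , factorial⇒complete factorial , λ {_} x → x)
      , (λ (y₀ , y₀∉) → extend y₀∉ (proj₂ (surjective y₀)) moving-letters)
      ]′ (factorial? A↔k (regular-Star regular-X))
      where
      extend : ∀ {y₀ y₁} → ¬ Factors (Star X) y₀ → θ y₁ ≡ y₀ →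
               (∃₂ λ a b → b ≢ a × (∀ w → (∀ v → θ v ≡ v) ⊎ θ (marker a b w) ≢ marker a b w)) →
               ∃[ Z ] (IsRegular Z × Independent (Underline θ) Z × IsCode Z × IsComplete Z × X ⊆ Z)
      extend {y₀} {y₁} y₀∉ θy₁≡y₀ (a , b , b≢a , moves) =
        Z , regular-Z ,
        (λ {_} → independent-∪ homo injective surjective {y = y} independent-X (moves core)
          Y-prefix Y-suffix θy₁≡y₀
          (⊑-marker a b (y₀ , y₁ , refl)) (⊑-marker a b (y₀ ++ θ y₀ , [] , y₁⊑)) y₀⋢X) ,
        code-Z , factorial⇒complete Z*-factorial , inj₁
        where
        -- Containing `y₀` keeps `y` from being a factor of `Star X`; `θ y₀` and its counterpart
        -- `y₁` under the inverse are there for independence.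
        core = y₀ ++ θ y₀ ++ y₁
        y = marker a b core
        y₁⊑ : core ≡ (y₀ ++ θ y₀) ++ y₁ ++ []
        y₁⊑ = trans (sym (++-assoc y₀ (θ y₀) y₁)) (cong ((y₀ ++ θ y₀) ++_) (sym (++-identityʳ y₁)))
        y₀⋢X : ∀ {x} → X x → ¬ y₀ ⊑ x
        y₀⋢X x (u , v , e) = y₀∉ (u , v , subst (Star X) e (⊆Star x))
        y∉ : ¬ Factors (Star X) y
        y∉ (u , v , s) with ⊑-trans (⊑-marker a b ([] , θ y₀ ++ y₁ , refl)) (u , v , refl)
        ... | p , q , e = y₀∉ (p , q , subst (Star X) e s)
        open Completion letter≟ X regular-X code-X {y} (λ ()) (unbordered-marker letter≟ b≢a core) y∉

proposition6p8 : ∀ {A : Set} {k : ℕ} → A ↔ Fin k → 2 ≤ k →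
    ∀ (θ : Word A → Word A) → IsAutomorphism θ ⊎ IsAntiAutomorphism θ →
    ∀ (X : Language A) → IsRegular X → Independent (Underline θ) X → IsCode X →
    ∃[ Z ] (IsRegular Z × Independent (Underline θ) Z × IsCode Z × IsComplete Z × X ⊆ Z)
proposition6p8 A↔k 2≤k θ (inj₁ auto) =
  completion A↔k 2≤k (inj₁ homo) injective (λ w → let v , e = surjective w in v , e refl)
  where open MonoidMorphisms.IsMonoidIsomorphism auto
proposition6p8 A↔k 2≤k θ (inj₂ anti) =
  completion A↔k 2≤k (inj₂ anti-homo) (proj₁ bijective) (λ w → let v , e = proj₂ bijective w in v , e refl)
  where open IsAntiAutomorphism anti
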